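{- For every graph $G$ and every end $\omega$ of $G$ the following assertions are equivalent: (i) The end space of $G$ is first countable at $\omega$. (ii) The direction $f_\omega$ is countably determined in $G$. (iii) The end $\omega$ is represented by a directional ray (that is, some ray in $\omega$ is directional in $G$). (iv) The end $\omega$ is represented by a topological ray (that is, some ray in $\omega$ is topological in $G$).
   Context: Graphs may be infinite of any cardinality. Countable means finite or countably infinite. A ray is a one-way infinite path. Two rays in $G$ are equivalent if no finite set of vertices separates them; the equivalence classes are the ends of $G$, and $\Omega(G)$ is the set of ends. For finite $X\subseteq V(G)$ and $\omega\in\Omega(G)$, $C(X,\omega)$ is the unique component of $G-X$ that contains a tail of every ray in $\omega$. For a component $C$ of $G-X$ let $\Omega(X,C)=\{\omega\in\Omega(G): C(X,\omega)=C\}$, and $\Omega(X,\omega):=\Omega(X,C(X,\omega))$. The end space of $G$ is $\Omega(G)$ with the topology having as a basis all sets $\Omega(X,C)$, with $X\subseteq V(G)$ finite and $C$ a component of $G-X$. A space is first countable at a point if it has a countable neighbourhood base at that point. A direction of $G$ is a map $f$ that assigns to every finite set $X\subseteq V(G)$ a component $f(X)$ of $G-X$ such that $f(X)\supseteq f(X')$ whenever $X\subseteq X'$. Every end $\omega$ defines a direction $f_\omega$ by $f_\omega(X)=C(X,\omega)$; a ray in $\omega$ is said to induce $f_\omega$. A directional choice in $G$ is a pair $(X,C)$ of a finite set $X\subseteq V(G)$ and a component $C$ of $G-X$. It distinguishes a direction $f$ from another direction $h$ if $f(X)=C$ and $h(X)\neq C$. A direction $f$ is countably determined in $G$ if there is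 a countable set of directional choices in $G$ that distinguish $f$ from every other direction of $G$. For a ray $R\subseteq G$, every finite initial segment of $R$, with vertex set $X$ say, defines the directional choice $(X,C)$ where $C$ is the component of $G-X$ containing $R-X$. The ray $R$ is directional in $G$ if the direction induced by $R$ is distinguished from every other direction of $G$ by the directional choices defined by the finite initial segments of $R$. The ray $R$, belonging to the end $\omega$, is topological in $G$ if $\{\Omega(X_n,\omega): n\in\mathbb N\}$ is a neighbourhood base of $\omega$ in $\Omega(G)$, where $X_n$ consists of the first $n$ vertices of $R$. -}

module Defs where

open import Axiom.ExcludedMiddle using (ExcludedMiddle)
open import Data.List.Base using (List; []; _∷_; _++_; applyUpTo)
open import Data.List.Membership.Propositional using (_∉_)
open import Data.List.Membership.Propositional.Properties
  using (∈-applyUpTo⁺; ∈-applyUpTo⁻; ∈-++⁺ˡ; ∈-++⁺ʳ)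
import Data.List.Relation.Binary.Subset.Propositional as List
open import Data.List.Relation.Unary.Any using (here; there)
open import Data.Nat.Base using (ℕ; suc; _≤_; _⊔_; _≤′_; ≤′-refl; ≤′-step)
open import Data.Nat.Properties
  using (≤-refl; ≤-trans; <-irrefl; ≮⇒≥; m≤m⊔n; m≤n⊔m; m≤n⇒m≤1+n; ≤⇒≤′; ≤′⇒≤)
open import Data.Product.Base using (Σ; ∃; _×_; _,_; proj₁; proj₂)
open import Function.Bundles using (_↣_)
open import Function.Definitions using (Injective)
open import Level using (Level; Setω) renaming (suc to lsuc)
open import Relation.Binary.Construct.Closure.ReflexiveTransitive
  using (Star; ε; _◅_; _◅◅_)
import Relation.Binary.Construct.Closure.ReflexiveTransitive as Star
open import Relation.Binary.Core using (Rel)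
open import Relation.Binary.Definitions using (Symmetric; Irreflexive; _Respects_)
open import Relation.Binary.PropositionalEquality using (_≡_; sym; trans)
open import Relation.Nullary using (¬_; yes; no)
open import Relation.Nullary.Decidable using (decidable-stable)
open import Relation.Unary using (Pred; _⊆_; _≐_)

-- The ambient classical logic.  As existence is read as Σ, deciding every type
-- also yields the axiom of choice.
Classical : Setω
Classical = ∀ {a} → ExcludedMiddle a

record Graph (ℓ : Level) : Set (lsuc ℓ) where
  field
    V           : Set ℓ
    Adj         : Rel V ℓ
    adj-sym     : Symmetric Adj
    adj-irrefl  : Irreflexive _≡_ Adj

module _ {ℓ : Level} (G : Graph ℓ) where
  open Graph G

  -- A finite set of vertices is given by a list; only membership in the list matters.
  FinSet : Set ℓ
  FinSet = List V

  Off : FinSet → Pred V ℓ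
  Off X v = v ∉ X

  -- There is a walk from u to v all of whose vertices, including u and v, lie in S.
  Linked : Pred V ℓ → Rel V ℓ
  Linked S u v = S u × Star (λ x y → Adj x y × S y) u v

  -- The subgraph induced by S is nonempty and connected.
  Connected : Pred V ℓ → Set ℓ
  Connected S = ∃ S × (∀ {u v} → S u → S v → Linked S u v)

  -- Components of G - X are induced subgraphs, so they are given by their vertex sets.
  record Component (X : FinSet) : Set (lsuc ℓ) where
    field
      verts      : Pred V ℓ
      off        : verts ⊆ Off X
      connected  : Connected verts
      maximal    : ∀ (D : Pred V ℓ) → D ⊆ Off X → Connected D → verts ⊆ D → D ⊆ verts

  open Component public using (verts)

  record Ray : Set ℓ where
    field
      at         : ℕ → V
      injective  : Injective _≡_ _≡_ at
      adjacent   : ∀ n → Adj (at n) (at (suc n))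

  open Ray public using (at)

  -- Every path of G between the two rays meets X.
  Separates : FinSet → Ray → Ray → Set ℓ
  Separates X R S = ∀ m n → ¬ Linked (Off X) (at R m) (at S n)

  _∼_ : Rel Ray ℓ
  R ∼ S = ¬ (∃ λ X → Separates X R S)

  -- An end is an equivalence class of rays, as a set of rays.
  record End : Set (lsuc ℓ) where
    field
      rays     : Pred Ray ℓ
      isClass  : ∃ λ R → rays ≐ (R ∼_)

  open End public using (rays)

  _≈ᴱ_ : Rel End ℓ
  ω ≈ᴱ ω′ = rays ω ≐ rays ω′

  endOf : Ray → End
  endOf R = record { rays = R ∼_ ; isClass = R , (λ p → p) , (λ p → p) }

  -- The set of the first n vertices of R.
  initial : Ray → ℕ → FinSet
  initial R n = applyUpTo (at R) n

  ContainsTail : Pred V ℓ → Ray → Set ℓ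
  ContainsTail C R = ∃ λ n → ∀ m → n ≤ m → C (at R m)

  ContainsTails : Pred V ℓ → End → Set ℓ
  ContainsTails C ω = ∀ R → rays ω R → ContainsTail C R

  linked-sym : ∀ {S u v} → Linked S u v → Linked S v u
  linked-sym {S} (su , w) = go su w
    where
    go : ∀ {u v} → S u → Star (λ x y → Adj x y × S y) u v → Linked S v u
    go su ε = su , ε
    go su ((a , sx) ◅ w) with go sx w
    ... | sv , w′ = sv , w′ ◅◅ ((adj-sym a , su) ◅ ε)

  linked-trans : ∀ {S u v w} → Linked S u v → Linked S v w → Linked S u w
  linked-trans (su , p) (_ , q) = su , p ◅◅ q

  linked-mono : ∀ {S T u v} → S ⊆ T → Linked S u v → Linked T u v
  linked-mono S⊆T (su , p) = S⊆T su , Star.map (λ { (a , s) → a , S⊆T s }) p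

  componentOf : ∀ X u → Off X u → Component X
  componentOf X u u∉X = record
    { verts      = C
    ; off        = λ c → proj₁ (linked-sym c)
    ; connected  = (u , u∉X , ε) ,
                   λ ca cb → ca , within ca (proj₂ (linked-trans (linked-sym ca) cb))
    ; maximal    = λ D D⊆ (_ , conn) C⊆D d → linked-mono D⊆ (conn (C⊆D (u∉X , ε)) d)
    }
    where
    C : Pred V ℓ
    C = Linked (Off X) u

    within : ∀ {a b} → C a → Star (λ x y → Adj x y × Off X y) a b →
             Star (λ x y → Adj x y × C y) a b
    within ca ε = ε
    within (u∉ , w) ((a , o) ◅ p) = (a , cx) ◅ within cx p
      where cx = u∉ , w ◅◅ ((a , o) ◅ ε)

  component-closed : ∀ {X} (C : Component X) {u v} →
                     verts C u → Linked (Off X) u v → verts C v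
  component-closed {X} C {u} cu l@(u∉X , _) =
    maximal (verts K) (Component.off K) (Component.connected K)
      (λ c → linked-mono off (proj₂ connected cu c)) l
    where
    open Component C using (off; connected; maximal)
    K = componentOf X u u∉X

  next∉initial : ∀ R n → Off (initial R n) (at R n)
  next∉initial R n p with ∈-applyUpTo⁻ (at R) p
  ... | i , i<n , eq = <-irrefl (sym (Ray.injective R eq)) i<n

  tail-linked : ∀ {X} (R : Ray) n → (∀ m → n ≤ m → Off X (at R m)) →
                ∀ m → n ≤ m → Linked (Off X) (at R n) (at R m)
  tail-linked {X} R n out m n≤m = go (≤⇒≤′ n≤m)
    where
    go : ∀ {m} → n ≤′ m → Linked (Off X) (at R n) (at R m)
    go ≤′-refl = out n ≤-refl , ε
    go (≤′-step {m} p) =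
      linked-trans (go p)
        (out m (≤′⇒≤ p) ,
          (Ray.adjacent R m , out (suc m) (m≤n⇒m≤1+n (≤′⇒≤ p))) ◅ ε)

  later∉initial : ∀ R n m → n ≤ m → Off (initial R n) (at R m)
  later∉initial R n m n≤m p with ∈-applyUpTo⁻ (at R) p
  ... | i , i<n , eq =
    <-irrefl (sym (Ray.injective R eq)) (≤-trans i<n n≤m)

  -- The component of G - initial R n containing R - initial R n.
  tailComponent : ∀ R n → Component (initial R n)
  tailComponent R n = componentOf (initial R n) (at R n) (next∉initial R n)

  tailComponent-contains : ∀ R n m → n ≤ m → verts (tailComponent R n) (at R m)
  tailComponent-contains R n = tail-linked R n (later∉initial R n)

  DirectionalChoice : Set (lsuc ℓ)
  DirectionalChoice = ∃ Component

  record Direction : Set (lsuc ℓ) where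
    field
      assign  : ∀ X → Component X
      mono    : ∀ {X X′} → X List.⊆ X′ → verts (assign X′) ⊆ verts (assign X)

  open Direction public using (assign)

  _≈ᴰ_ : Rel Direction ℓ
  f ≈ᴰ h = ∀ X → verts (assign f X) ≐ verts (assign h X)

  Distinguishes : DirectionalChoice → Direction → Direction → Set ℓ
  Distinguishes (X , C) f h =
    verts (assign f X) ≐ verts C × ¬ (verts (assign h X) ≐ verts C)

  DistinguishFromOthers : {I : Set} → (I → DirectionalChoice) → Direction → Set (lsuc ℓ)
  DistinguishFromOthers c f = ∀ h → ¬ (f ≈ᴰ h) → ∃ λ i → Distinguishes (c i) f h

  -- Countable (finite or infinite) sets are families indexed by a type that embeds in ℕ.
  CountablyDetermined : Direction → Set (lsuc ℓ)
  CountablyDetermined f =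
    Σ Set λ I → (I ↣ ℕ) × Σ (I → DirectionalChoice) λ c → DistinguishFromOthers c f

  module _ (em : Classical) where

    avoids : ∀ X (R : Ray) → ContainsTail (Off X) R
    avoids [] R = 0 , λ _ _ ()
    avoids (x ∷ X) R with avoids X R | em {P = ∃ λ k → at R k ≡ x}
    ... | n , out | no ¬k = n , λ where
      m _   (here eq)  → ¬k (m , eq)
      m n≤m (there p)  → out m n≤m p
    ... | n , out | yes (k , Rk≡x) = suc k ⊔ n , λ where
      m le (here eq) →
        <-irrefl (Ray.injective R (trans Rk≡x (sym eq))) (≤-trans (m≤m⊔n (suc k) n) le)
      m le (there p) → out m (≤-trans (m≤n⊔m (suc k) n) le) p

    tails-linked : ∀ X {R S} → R ∼ S → ∀ k l →
                   ∃ λ i → ∃ λ j → k ≤ i × l ≤ j × Linked (Off X) (at R i) (at S j)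
    tails-linked X {R} {S} R∼S k l = decidable-stable em λ none →
      R∼S (Y , λ i j lk → none
        ( i , j
        , ≮⇒≥ (λ i<k → proj₁ lk
            (∈-++⁺ʳ X (∈-++⁺ˡ (∈-applyUpTo⁺ (at R) i<k))))
        , ≮⇒≥ (λ j<l → proj₁ (linked-sym lk)
            (∈-++⁺ʳ X (∈-++⁺ʳ (initial R k) (∈-applyUpTo⁺ (at S) j<l))))
        , linked-mono (λ v∉Y v∈X → v∉Y (∈-++⁺ˡ v∈X)) lk))
      where
      Y = X ++ (initial R k ++ initial S l)

    endComponent-exists : ∀ X ω → Σ (Component X) λ C → ContainsTails (verts C) ω
    endComponent-exists X ω with End.isClass ω
    ... | R , rays⊆ , _ with avoids X R
    ... | k , outR = componentOf X (at R k) (outR k ≤-refl) , contains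
      where
      contains : ∀ S → rays ω S → ContainsTail (Linked (Off X) (at R k)) S
      contains S S∈ω with avoids X S
      ... | l , outS with tails-linked X {R} {S} (rays⊆ S∈ω) k l
      ... | i , j , k≤i , l≤j , lk = l , λ m l≤m →
        linked-trans (tail-linked R k outR i k≤i)
          (linked-trans lk
            (linked-trans (linked-sym (tail-linked S l outS j l≤j))
              (tail-linked S l outS m l≤m)))

    -- C(X,ω)
    endComponent : ∀ X → End → Component X
    endComponent X ω = proj₁ (endComponent-exists X ω)

    endComponent-tails : ∀ X ω → ContainsTails (verts (endComponent X ω)) ω
    endComponent-tails X ω = proj₂ (endComponent-exists X ω)

    ∼-refl : ∀ R → R ∼ R
    ∼-refl R (X , sep) with avoids X R
    ... | n , out = sep n n (out n ≤-refl , ε)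

    tails⊆ : ∀ {X X′} ω (C : Component X) (C′ : Component X′) → X List.⊆ X′ →
             ContainsTails (verts C) ω → ContainsTails (verts C′) ω → verts C′ ⊆ verts C
    tails⊆ ω C C′ X⊆X′ t t′ c′ with End.isClass ω
    ... | R , _ , ⊆rays with t R (⊆rays (∼-refl R)) | t′ R (⊆rays (∼-refl R))
    ... | n , inC | n′ , inC′ =
      component-closed C (inC (n ⊔ n′) (m≤m⊔n n n′))
        (linked-mono (λ d p → Component.off C′ d (X⊆X′ p))
          (proj₂ (Component.connected C′) (inC′ (n ⊔ n′) (m≤n⊔m n n′)) c′))

    endComponent-unique : ∀ X ω (C : Component X) → ContainsTails (verts C) ω →
                          verts C ≐ verts (endComponent X ω)
    endComponent-unique X ω C t =
      tails⊆ ω K C (λ p → p) (endComponent-tails X ω) t ,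
      tails⊆ ω C K (λ p → p) t (endComponent-tails X ω)
      where K = endComponent X ω

    endDirection : End → Direction
    endDirection ω = record
      { assign  = λ X → endComponent X ω
      ; mono    = λ {X} {X′} X⊆X′ →
          tails⊆ ω (endComponent X ω) (endComponent X′ ω) X⊆X′
            (endComponent-tails X ω) (endComponent-tails X′ ω)
      }

    Directional : Ray → Set (lsuc ℓ)
    Directional R =
      DistinguishFromOthers (λ n → initial R n , tailComponent R n) (endDirection (endOf R))

    -- Sets of ends are predicates at level ℓ; classically this is no restriction.
    EndSet : Set (lsuc ℓ)
    EndSet = Pred End ℓ

    -- Ω(X,C)
    Ω : ∀ X → Component X → EndSet
    Ω X C ω = verts (endComponent X ω) ≐ verts C

    -- Ω(X,ω)
    Ωᴱ : FinSet → End → EndSet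
    Ωᴱ X ω = Ω X (endComponent X ω)

    -- U is a union of basic sets Ω(X,C).
    Open : EndSet → Set (lsuc ℓ)
    Open U = ∀ ω → U ω → ∃ λ X → Σ (Component X) λ C → Ω X C ω × Ω X C ⊆ U

    -- Ends are equal when they contain the same rays, so sets of ends must respect _≈ᴱ_;
    -- open sets do so automatically.
    Neighbourhood : End → EndSet → Set (lsuc ℓ)
    Neighbourhood ω N = N Respects _≈ᴱ_ × Σ EndSet λ U → Open U × U ω × U ⊆ N

    NeighbourhoodBase : End → {I : Set} → (I → EndSet) → Set (lsuc ℓ)
    NeighbourhoodBase ω B =
      (∀ i → Neighbourhood ω (B i)) × (∀ N → Neighbourhood ω N → ∃ λ i → B i ⊆ N)

    FirstCountableAt : End → Set (lsuc ℓ)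
    FirstCountableAt ω =
      Σ Set λ I → (I ↣ ℕ) × Σ (I → EndSet) λ B → NeighbourhoodBase ω B

    Topological : Ray → Set (lsuc ℓ)
    Topological R = NeighbourhoodBase (endOf R) (λ n → Ωᴱ (initial R n) (endOf R))

{-# OPTIONS --safe #-}

-- A direction f has greedy rays v₀v₁…, whose vertex vₙ lies in f({v₀,…,vₙ₋₁}).
-- While building such a ray, any given vertex u can be expelled from f({v₀,…,vₙ}):
-- follow a walk inside the current component to u until u is either used or cut off.
-- If directional choices (Xᵢ,Cᵢ) determine f, a greedy ray that expels the countably
-- many vertices of the Xᵢ is directional, since a direction agreeing with f on a
-- finite set P for which f(P) avoids Xᵢ also agrees with f on Xᵢ.  This is (ii)⇒(iii).
-- A greedy ray of a direction h started from X stays in h(X), so h(X) contains an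
-- end; this lets bases at an end separate it from directions, for (i)⇒(ii), (iv)⇒(iii).
-- For (iii)⇒(iv), an end that is close to ω along R but separated from ω by X must
-- connect through a vertex of X that R never cuts off, so R cannot tell it from ω.
module Submission where

open import Data.List.Base using ([]; _∷_; _++_)
open import Data.List.Membership.Propositional using (_∈_; _∉_)
open import Data.List.Membership.Propositional.Properties
  using (∈-applyUpTo⁺; ∈-applyUpTo⁻; ∈-++⁺ˡ; ∈-++⁺ʳ)
import Data.List.Relation.Binary.Subset.Propositional as List
open import Data.List.Relation.Unary.Any using (here; there)
open import Data.Nat.Base
  using (ℕ; zero; suc; _≤_; _<_; z≤n; s≤s; s≤s⁻¹; _⊔_; _≤′_; ≤′-refl; ≤′-step)
open import Data.Nat.Properties
  using (≤-refl; ≤-trans; ≤⇒≤′; n≤1+n; <-cmp; <-≤-connex; m≤m⊔n; m≤n⊔m)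
open import Data.Product.Base using (Σ; ∃; _×_; _,_; proj₁; proj₂)
open import Data.Sum.Base using (inj₁; inj₂)
open import Function.Base using (_∘_)
open import Function.Bundles using (_↣_; _⇔_; mk⇔; Injection)
open import Function.Construct.Identity using (↣-id)
open import Level using () renaming (suc to lsuc)
open import Relation.Binary.Construct.Closure.ReflexiveTransitive using (Star; ε; _◅_; _◅◅_)
open import Relation.Binary.Core using (Rel)
open import Relation.Binary.Definitions using (tri<; tri≈; tri>)
open import Relation.Binary.PropositionalEquality using (_≡_; _≢_; refl; sym; subst)
open import Relation.Nullary using (¬_; yes; no; contradiction)
open import Relation.Nullary.Decidable using (decidable-stable)
open import Relation.Unary using (Pred; _⊆_; _≐_; _∩_)
open import Relation.Unary.Properties using (≐-refl; ≐-sym; ≐-trans)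
open import Defs

module _ (em : Classical) {ℓ} (G : Graph ℓ) where
  open Graph G

  -- Classical reasoning and walks

  stable : ∀ {a} {A : Set a} → ¬ ¬ A → A
  stable = decidable-stable em

  ¬∀⇒∃¬ : ∀ {a b} {A : Set a} {B : A → Set b} → ¬ (∀ x → B x) → ∃ λ x → ¬ B x
  ¬∀⇒∃¬ ¬all = stable λ none → ¬all λ x → stable λ ¬b → none (x , ¬b)

  Walk : Pred V ℓ → Rel V ℓ
  Walk S = Star (λ x y → Adj x y × S y)

  length : ∀ {S u v} → Walk S u v → ℕ
  length ε       = 0
  length (_ ◅ w) = suc (length w)

  -- Cuts the walk just before it first leaves `K`. The crossing from `y` to `z` is dropped, so the
  -- rest is strictly shorter; `expel-vertex` terminates because of this bound.
  exit : ∀ {S K : Pred V ℓ} {u v} → K u → ¬ K v → (w : Walk S u v) →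
         ∃ λ y → ∃ λ z → Σ (Walk K u y) λ w′ →
           length {K} w′ < length {S} w × K y × Adj y z × S z × ¬ K z
  exit ku ¬kv ε = contradiction ku ¬kv
  exit {S} {K} ku ¬kv (_◅_ {j = z} (a , sz) w) with em {P = K z}
  ... | no ¬kz = _ , z , ε , s≤s z≤n , ku , a , sz , ¬kz
  ... | yes kz with exit {S} {K} kz ¬kv w
  ... | y , z′ , w′ , lt , rest = y , z′ , (a , kz) ◅ w′ , s≤s lt , rest

  -- Components

  component-linked : ∀ {X} (C : Component G X) {u v} → verts C u → verts C v →
                     Linked G (verts C) u v
  component-linked C = proj₂ (Component.connected C)

  component-linked-off : ∀ {X} (C : Component G X) {u v} → verts C u → verts C v →
                         Linked G (Off G X) u v
  component-linked-off C cu cv = linked-mono G (Component.off C) (component-linked C cu cv)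

  component-adjacent : ∀ {X} (C : Component G X) {u v} →
                       verts C u → Adj u v → v ∉ X → verts C v
  component-adjacent C cu a v∉X =
    component-closed G C cu (Component.off C cu , (a , v∉X) ◅ ε)

  overlap⇒⊆ : ∀ {X} (C D : Component G X) {u} → verts C u → verts D u → verts C ⊆ verts D
  overlap⇒⊆ C D cu du cv = component-closed G D du (component-linked-off C cu cv)

  overlap⇒≐ : ∀ {X} (C D : Component G X) {u} → verts C u → verts D u → verts C ≐ verts D
  overlap⇒≐ C D cu du = overlap⇒⊆ C D cu du , overlap⇒⊆ D C du cu

  component-inhabited : ∀ {X} (C : Component G X) → ∃ (verts C)
  component-inhabited C = proj₁ (Component.connected C)

  tails-unseparated : ∀ {X} (C : Component G X) R S →
    ContainsTail G (verts C) R → ContainsTail G (verts C) S → ¬ Separates G X R S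
  tails-unseparated C R S (m , inR) (n , inS) sep =
    sep m n (component-linked-off C (inR m ≤-refl) (inS n ≤-refl))

  -- Ends

  endComponent≐ : ∀ {X} ω S (C : Component G X) → rays ω S → ContainsTail G (verts C) S →
                  verts (endComponent G em X ω) ≐ verts C
  endComponent≐ {X} ω S C S∈ω (n , inC) with endComponent-tails G em X ω S S∈ω
  ... | m , inE =
    overlap⇒≐ (endComponent G em X ω) C (inE (m ⊔ n) (m≤m⊔n m n)) (inC (m ⊔ n) (m≤n⊔m m n))

  equivalent-of-∈ : ∀ ω R S → rays ω R → rays ω S → _∼_ G R S
  equivalent-of-∈ ω R S R∈ω S∈ω (X , sep) =
    tails-unseparated (endComponent G em X ω) R S
      (endComponent-tails G em X ω R R∈ω) (endComponent-tails G em X ω S S∈ω) sep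

  some-ray : ∀ ω → ∃ (rays {G = G} ω)
  some-ray ω with End.isClass ω
  ... | R , _ , ⊆rays = R , ⊆rays (∼-refl G em R)

  ∈-of-tails : ∀ ω R → (∀ X → ContainsTail G (verts (endComponent G em X ω)) R) → rays ω R
  ∈-of-tails ω R inR =
    let R₀ , _ , ⊆rays = End.isClass ω
    in ⊆rays λ (X , sep) → tails-unseparated (endComponent G em X ω) R₀ R
         (endComponent-tails G em X ω R₀ (⊆rays (∼-refl G em R₀))) (inR X) sep

  endOf≈ : ∀ ω R → rays ω R → _≈ᴱ_ G (endOf G R) ω
  endOf≈ ω R R∈ω with End.isClass ω
  ... | R₀ , _ , ⊆rays =
    (λ {S} R∼S → ⊆rays (equivalent-of-∈ (endOf G R) R₀ S
       (equivalent-of-∈ ω R R₀ R∈ω (⊆rays (∼-refl G em R₀))) R∼S)) ,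
    λ {S} → equivalent-of-∈ ω R S R∈ω

  endComponent-cong : ∀ X {ω ω′} → _≈ᴱ_ G ω ω′ →
                      verts (endComponent G em X ω) ≐ verts (endComponent G em X ω′)
  endComponent-cong X {ω} {ω′} ω≈ω′ with some-ray ω
  ... | R , R∈ω = endComponent≐ ω R (endComponent G em X ω′) R∈ω
                    (endComponent-tails G em X ω′ R (proj₁ ω≈ω′ R∈ω))

  endComponent-initial : ∀ R n →
    verts (endComponent G em (initial G R n) (endOf G R)) ≐ verts (tailComponent G R n)
  endComponent-initial R n =
    endComponent≐ (endOf G R) R (tailComponent G R n) (∼-refl G em R)
      (n , tailComponent-contains G R n)

  -- Directions

  distinguish-cong : ∀ {I : Set} (c : I → DirectionalChoice G) f g → _≈ᴰ_ G f g →
    DistinguishFromOthers G c f → DistinguishFromOthers G c g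
  distinguish-cong c f _ f≈g dist h g≉h
    with dist h (λ f≈h → g≉h λ X → ≐-trans (≐-sym (f≈g X)) (f≈h X))
  ... | i , f≐ , h≭ = i , ≐-trans (≐-sym (f≈g (proj₁ (c i)))) f≐ , h≭

  -- Finite sets are lists, so a reordered list is a different argument of `f`. This matters for a
  -- greedy ray from `[]`, whose `past n` reverses `initial`.
  direction-cong : ∀ (f : Direction G) {X Y} → X List.⊆ Y → Y List.⊆ X →
                   verts (assign f X) ≐ verts (assign f Y)
  direction-cong f X⊆Y Y⊆X = Direction.mono f Y⊆X , Direction.mono f X⊆Y

  Avoids : Pred V ℓ → FinSet G → Set ℓ
  Avoids C X = ∀ {v} → v ∈ X → ¬ C v

  -- Take vertices of `f (P ++ X)` and `h (P ++ X)`. Both lie in `f P`, which is connected and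
  -- avoids `X`, so they are linked off `X`. Hence `f X` and `h X` overlap.
  agree-of-avoids : ∀ (f h : Direction G) P X → verts (assign h P) ≐ verts (assign f P) →
    Avoids (verts (assign f P)) X → verts (assign f X) ≐ verts (assign h X)
  agree-of-avoids f h P X hP≐fP avoid
    with component-inhabited (assign f (P ++ X)) | component-inhabited (assign h (P ++ X))
  ... | y , fy | x , hx =
    overlap⇒≐ (assign f X) (assign h X)
      (component-closed G (assign f X) (right f fy)
        (linked-mono G (λ fPv v∈X → avoid v∈X fPv)
          (component-linked (assign f P) (left f fy) (proj₁ hP≐fP (left h hx)))))
      (right h hx)
    where
    left : ∀ (g : Direction G) → verts (assign g (P ++ X)) ⊆ verts (assign g P)
    left g = Direction.mono g ∈-++⁺ˡ
    right : ∀ (g : Direction G) → verts (assign g (P ++ X)) ⊆ verts (assign g X)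
    right g = Direction.mono g (∈-++⁺ʳ P)

  -- Greedy rays

  -- `past n` holds the first n vertices of the ray, latest first, followed by `X`. It is a field
  -- fixed by two equations, so that the lists carried by the states of the construction can be used
  -- directly.
  record GreedyRay (f : Direction G) (X : FinSet G) : Set ℓ where
    field
      ray       : Ray G
      past      : ℕ → FinSet G
      past-zero : past 0 ≡ X
      past-suc  : ∀ n → past (suc n) ≡ at ray n ∷ past n
      inside    : ∀ n → verts (assign f (past n)) (at ray n)

    past-mono : ∀ {m n} → m ≤ n → past m List.⊆ past n
    past-mono m≤n = go (≤⇒≤′ m≤n)
      where
      go : ∀ {m n} → m ≤′ n → past m List.⊆ past n
      go ≤′-refl p = p
      go (≤′-step {n} m≤n) p = subst (_ ∈_) (sym (past-suc n)) (there (go m≤n p))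

    tail-inside : ∀ m n → m ≤ n → verts (assign f (past m)) (at ray n)
    tail-inside m n m≤n = Direction.mono f (past-mono m≤n) (inside n)

  module _ {f : Direction G} (R : GreedyRay f []) where
    open GreedyRay R

    past⊆initial : ∀ n → past n List.⊆ initial G ray n
    past⊆initial zero {v} p with () ← subst (v ∈_) past-zero p
    past⊆initial (suc n) {v} p with subst (v ∈_) (past-suc n) p
    ... | here refl = ∈-applyUpTo⁺ (at ray) ≤-refl
    ... | there q with ∈-applyUpTo⁻ (at ray) (past⊆initial n q)
    ... | i , i<n , refl = ∈-applyUpTo⁺ (at ray) (≤-trans i<n (n≤1+n n))

    initial⊆past : ∀ n → initial G ray n List.⊆ past n
    initial⊆past n p with ∈-applyUpTo⁻ (at ray) p
    ... | i , i<n , refl =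
      past-mono i<n (subst (at ray i ∈_) (sym (past-suc i)) (here refl))

  module Greedy (f : Direction G) where

    -- `head` is the newest vertex of the ray, not yet recorded in `past`.
    record State : Set ℓ where
      constructor state
      field
        past   : FinSet G
        head   : V
        inside : verts (assign f past) head

    open State

    region : State → Pred V ℓ
    region s = verts (assign f (past s))

    infix 4 _⟶_ _⟶*_

    _⟶_ _⟶*_ : Rel State ℓ
    s ⟶ t = past t ≡ head s ∷ past s × Adj (head s) (head t)
    _⟶*_ = Star _⟶_

    region-mono : ∀ {s t} → s ⟶* t → region t ⊆ region s
    region-mono ε c = c
    region-mono {s} (_◅_ {j = t} (eq , _) w) c =
      Direction.mono f (λ p → subst (_ ∈_) (sym eq) (there p)) (region-mono w c)

    -- A walk into the head leaves f (head ∷ past) through the head only.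
    approach : ∀ s {u} → verts (assign f (head s ∷ past s)) u →
      (w : Walk (region s) u (head s)) →
      ∃ λ t → s ⟶ t × Σ (Walk (region t) u (head t)) λ w′ →
        length {region t} w′ < length {region s} w
    approach s fu w
      with exit {region s} {verts (assign f (head s ∷ past s))}
             fu (λ c → Component.off (assign f (head s ∷ past s)) c (here refl)) w
    ... | y , z , w′ , lt , fy , a , sz , ¬fz =
      state (head s ∷ past s) y fy , (refl , adj-sym (subst (Adj y) z≡head a)) , w′ , lt
      where
      z≡head : z ≡ head s
      z≡head = stable λ z≢ → ¬fz (component-adjacent (assign f (head s ∷ past s)) fy a λ where
        (here eq) → z≢ eq
        (there p) → Component.off (assign f (past s)) sz p)

    -- A walk to the head from any vertex of the next component leaves that component at a neighbour
    -- of the head, which becomes the new head.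
    advance : ∀ s → ∃ λ t → s ⟶ t
    advance s with component-inhabited (assign f (head s ∷ past s))
    ... | u , fu with approach s fu (proj₂ (component-linked (assign f (past s))
                        (Direction.mono f there fu) (inside s)))
    ... | t , st , _ = t , st

    -- Here `n` bounds the length of the walk from `u` to the head. Either the next step cuts `u`
    -- off, or `approach` yields a shorter walk inside the smaller region, so `u` is lost before the
    -- bound is used up.
    expel-vertex : ∀ n s {u} (w : Walk (region s) u (head s)) → length {region s} w < n →
                   ∃ λ t → s ⟶* t × ¬ region t u
    expel-vertex (suc n) s {u} w lt with em {P = verts (assign f (head s ∷ past s)) u}
    ... | no ¬fu = let t , st = advance s in
      t , st ◅ ε , λ c → ¬fu (subst (λ P → verts (assign f P) u) (proj₁ st) c)
    ... | yes fu with approach s fu w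
    ... | t , st , w′ , lt′ with expel-vertex n t w′ (≤-trans lt′ (s≤s⁻¹ lt))
    ... | t′ , sts , out = t′ , st ◅ sts , out

    -- Vertices are expelled one by one. Regions only shrink, so those expelled earlier stay
    -- outside.
    expel : ∀ X s → ∃ λ t → s ⟶* t × Avoids (region t) X
    expel [] s = s , ε , λ ()
    expel (x ∷ X) s with expel X s
    ... | t , st , out with em {P = region t x}
    ... | no ¬c = t , st , λ { (here refl) → ¬c ; (there p) → out p }
    ... | yes c with component-linked (assign f (past t)) c (inside t)
    ... | _ , w with expel-vertex (suc (length {region t} w)) t w ≤-refl
    ... | t′ , tt′ , ¬c′ = t′ , st ◅◅ tt′ , λ where
      (here refl) → ¬c′
      (there p)   → λ c′ → out p (region-mono tt′ c′)

    -- Expelling a finite set takes a finite but unknown number of steps. A stage stores the steps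
    -- still to be taken towards its first goal, so that `next` can perform one step at a time.
    record Stage : Set ℓ where
      constructor stage
      field
        {now target} : State
        goals        : ℕ → FinSet G
        plan         : now ⟶* target
        success      : Avoids (region target) (goals 0)

    open Stage

    begin : (ℕ → FinSet G) → State → Stage
    begin goals s = let t , st , out = expel (goals 0) s in stage goals st out

    next : Stage → Stage
    -- `expel` may return an empty plan, so a step is taken before planning for the next goal; thus
    -- every call of `next` lengthens the ray.
    next (stage {s} goals ε _)         = begin (goals ∘ suc) (proj₁ (advance s))
    next (stage goals (_ ◅ plan) out)  = stage goals plan out

    run : ℕ → Stage → Stage
    run zero    σ = σ
    run (suc n) σ = run n (next σ)

    next-⟶ : ∀ σ → now σ ⟶ now (next σ)
    next-⟶ (stage {s} goals ε _)        = proj₂ (advance s)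
    next-⟶ (stage goals (st ◅ _) out)   = st

    run-⟶ : ∀ n σ → now (run n σ) ⟶ now (run (suc n) σ)
    run-⟶ zero    σ = next-⟶ σ
    run-⟶ (suc n) σ = run-⟶ n (next σ)

    -- The current plan is followed to its end. There goal 0 is met, and goal `suc k` becomes goal
    -- `k` of the shifted sequence.
    run-expels : ∀ k {s t} goals (plan : s ⟶* t) (out : Avoids (region t) (goals 0)) →
                 ∃ λ n → Avoids (region (now (run n (stage goals plan out)))) (goals k)
    run-expels k goals (st ◅ plan) out with run-expels k goals plan out
    ... | n , p = suc n , p
    run-expels zero goals ε out = 0 , out
    run-expels (suc k) {s} goals ε out =
      let t , plan , out′ = expel (goals 1) (proj₁ (advance s))
          n , p = run-expels k (goals ∘ suc) plan out′
      in suc n , p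

    ray-through : ∀ X (goals : ℕ → FinSet G) → Σ (GreedyRay f X) λ R →
      ∀ k → ∃ λ n → Avoids (verts (assign f (GreedyRay.past R n))) (goals k)
    ray-through X goals = greedy , λ k → run-expels k goals (Stage.plan σ) (Stage.success σ)
      where
      start : State
      start = let u , fu = component-inhabited (assign f X) in state X u fu

      σ : Stage
      σ = begin goals start

      s : ℕ → State
      s n = now (run n σ)

      head-recorded : ∀ {m n} → suc m ≤′ n → head (s m) ∈ past (s n)
      head-recorded {m} ≤′-refl = subst (head (s m) ∈_) (sym (proj₁ (run-⟶ m σ))) (here refl)
      head-recorded {m} (≤′-step {n} m<n) =
        subst (head (s m) ∈_) (sym (proj₁ (run-⟶ n σ))) (there (head-recorded m<n))

      -- A head lies off its own `past`, where all earlier heads are recorded.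
      head-fresh : ∀ {m n} → m < n → head (s m) ≢ head (s n)
      head-fresh {m} {n} m<n eq = Component.off (assign f (past (s n))) (inside (s n))
        (subst (_∈ past (s n)) eq (head-recorded (≤⇒≤′ m<n)))

      heads-injective : ∀ {m n} → head (s m) ≡ head (s n) → m ≡ n
      heads-injective {m} {n} eq with <-cmp m n
      ... | tri< m<n _ _ = contradiction eq (head-fresh m<n)
      ... | tri≈ _ m≡n _ = m≡n
      ... | tri> _ _ n<m = contradiction (sym eq) (head-fresh n<m)

      greedy : GreedyRay f X
      greedy = record
        { ray       = record
          { at        = λ n → head (s n)
          ; injective = heads-injective
          ; adjacent  = λ n → proj₂ (run-⟶ n σ)
          }
        ; past      = λ n → past (s n)
        ; past-zero = refl
        ; past-suc  = λ n → proj₁ (run-⟶ n σ)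
        ; inside    = λ n → inside (s n)
        }

  ray-inside : ∀ (f : Direction G) X → ∃ λ R → ∀ n → verts (assign f X) (at {G = G} R n)
  ray-inside f X with Greedy.ray-through f X (λ _ → [])
  ... | R , _ = ray , λ n →
    subst (λ P → verts (assign f P) (at ray n)) past-zero (tail-inside 0 n z≤n)
    where open GreedyRay R

  -- Neighbourhoods

  -- For a ray `R` in `ω`, the end `endOf G R` agrees with `ω` only up to `_≈ᴱ_`; this and the next
  -- two lemmas move topological statements across that relation.
  open-cong : ∀ {U ω ω′} → Open G em U → _≈ᴱ_ G ω ω′ → U ω → U ω′
  open-cong {ω = ω} {ω′} op ω≈ω′ Uω with op ω Uω
  ... | X , C , ω∈Ω , Ω⊆U = Ω⊆U {ω′} (≐-trans (≐-sym (endComponent-cong X {ω} {ω′} ω≈ω′)) ω∈Ω)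

  neighbourhood-cong : ∀ {ω ω′ N} → _≈ᴱ_ G ω ω′ →
                       Neighbourhood G em ω N → Neighbourhood G em ω′ N
  neighbourhood-cong {ω} {ω′} ω≈ω′ (resp , U , op , Uω , U⊆N) =
    resp , U , op , open-cong {U} {ω} {ω′} op ω≈ω′ Uω , λ {x} → U⊆N {x}

  base-cong : ∀ {ω ω′ I} {B : I → EndSet G em} → _≈ᴱ_ G ω ω′ →
              NeighbourhoodBase G em ω B → NeighbourhoodBase G em ω′ B
  base-cong {ω} {ω′} {B = B} ω≈ω′ (nbhd , fine) =
    (λ i → neighbourhood-cong {ω} {ω′} {B i} ω≈ω′ (nbhd i)) ,
    λ N nN → fine N (neighbourhood-cong {ω′} {ω} {N} (≐-sym ω≈ω′) nN)

  Ω-neighbourhood : ∀ X (C : Component G X) ω → Ω G em X C ω →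
                    Neighbourhood G em ω (Ω G em X C)
  Ω-neighbourhood X C ω ω∈Ω =
    (λ {x} {y} x≈y x∈Ω → ≐-trans (≐-sym (endComponent-cong X {x} {y} x≈y)) x∈Ω) ,
    Ω G em X C , (λ _ x∈Ω → X , C , x∈Ω , λ p → p) , ω∈Ω , λ p → p

  -- Let `h` differ from the direction of `ω` at `X`, and choose `i` from the base property. If
  -- `h Xᵢ` were the chosen component, the end of a ray of `h` would lie in its `Ω` and hence in
  -- `Ωᴱ X ω`, making the two directions agree at `X`.
  base-distinguishes : ∀ {I : Set} ω (c : I → DirectionalChoice G) →
    (∀ i → Ω G em (proj₁ (c i)) (proj₂ (c i)) ω) →
    (∀ X → ∃ λ i → Ω G em (proj₁ (c i)) (proj₂ (c i)) ⊆ Ωᴱ G em X ω) →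
    DistinguishFromOthers G c (endDirection G em ω)
  base-distinguishes ω c ω∈ base h f≉h with ¬∀⇒∃¬ f≉h
  ... | X , fX≭hX with base X
  ... | i , Ω⊆ = i , ω∈ i , λ hXᵢ≐C → fX≭hX
    (≐-trans (≐-sym (Ω⊆ {endOf G R} (≐-trans (R-in ∈-++⁺ˡ) hXᵢ≐C))) (R-in (∈-++⁺ʳ Xᵢ)))
    where
    Xᵢ : FinSet G
    Xᵢ = proj₁ (c i)

    -- The ray lies in `h (Xᵢ ++ X)`, so its end follows `h` at both `Xᵢ` and `X`, although `h` is
    -- not assumed to come from an end.
    R : Ray G
    R = proj₁ (ray-inside h (Xᵢ ++ X))

    R-in : ∀ {Y} → Y List.⊆ (Xᵢ ++ X) →
           verts (endComponent G em Y (endOf G R)) ≐ verts (assign h Y)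
    R-in {Y} Y⊆ = endComponent≐ (endOf G R) R (assign h Y) (∼-refl G em R)
      (0 , λ m _ → Direction.mono h Y⊆ (proj₂ (ray-inside h (Xᵢ ++ X)) m))

  -- Direct implications between the four assertions

  firstCountable⇒countablyDetermined : ∀ ω →
    FirstCountableAt G em ω → CountablyDetermined G (endDirection G em ω)
  firstCountable⇒countablyDetermined ω (I , I↣ℕ , B , nbhd , fine) =
    I , I↣ℕ , c , base-distinguishes ω c (λ i → proj₁ (proj₂ (proj₂ (inner i)))) base
    where
    -- Each `B i` is shrunk to a basic open set around `ω`, which is a directional choice with the
    -- same index.
    inner : ∀ i → ∃ λ X → Σ (Component G X) λ C → Ω G em X C ω × Ω G em X C ⊆ B i
    inner i =
      let _ , U , op , Uω , U⊆B = nbhd i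
          X , C , ω∈Ω , Ω⊆U = op ω Uω
      in X , C , ω∈Ω , λ {x} x∈Ω → U⊆B {x} (Ω⊆U {x} x∈Ω)

    c : I → DirectionalChoice G
    c i = proj₁ (inner i) , proj₁ (proj₂ (inner i))

    base : ∀ X → ∃ λ i → Ω G em (proj₁ (c i)) (proj₂ (c i)) ⊆ Ωᴱ G em X ω
    base X =
      let i , B⊆ = fine (Ωᴱ G em X ω) (Ω-neighbourhood X (endComponent G em X ω) ω ≐-refl)
      in i , λ {x} x∈Ω → B⊆ {x} (proj₂ (proj₂ (proj₂ (inner i))) {x} x∈Ω)

  topological⇒directional : ∀ R → Topological G em R → Directional G em R
  topological⇒directional R (_ , fine) =
    base-distinguishes ω (λ n → initial G R n , tailComponent G R n) (endComponent-initial R) base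
    where
    ω : End G
    ω = endOf G R

    base : ∀ X → ∃ λ n → Ω G em (initial G R n) (tailComponent G R n) ⊆ Ωᴱ G em X ω
    base X =
      let n , B⊆ = fine (Ωᴱ G em X ω) (Ω-neighbourhood X (endComponent G em X ω) ω ≐-refl)
      in n , λ {x} x∈Ω → B⊆ {x} (≐-trans x∈Ω (≐-sym (endComponent-initial R n)))

  topological⇒firstCountable : ∀ ω {R} → rays ω R → Topological G em R →
                               FirstCountableAt G em ω
  topological⇒firstCountable ω {R} R∈ω top =
    ℕ , ↣-id ℕ , (λ n → Ωᴱ G em (initial G R n) (endOf G R)) ,
    base-cong {endOf G R} {ω} (endOf≈ ω R R∈ω) top

  directional⇒countablyDetermined : ∀ ω {R} → rays ω R → Directional G em R →
    CountablyDetermined G (endDirection G em ω)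
  directional⇒countablyDetermined ω {R} R∈ω dir =
    ℕ , ↣-id ℕ , c , distinguish-cong c (endDirection G em (endOf G R)) (endDirection G em ω)
      (λ X → endComponent-cong X {endOf G R} {ω} (endOf≈ ω R R∈ω)) dir
    where
    c : ℕ → DirectionalChoice G
    c n = initial G R n , tailComponent G R n

  -- From countably determined directions to directional rays

  -- Unlike `Directional`, this refers to `f` and not to the end of the ray, so it can be used
  -- before that end is known to induce `f`.
  Determines : ∀ {f X} → GreedyRay f X → Set (lsuc ℓ)
  Determines {f} R = ∀ h → (∀ n → verts (assign h (past n)) ≐ verts (assign f (past n))) →
                     _≈ᴰ_ G f h
    where open GreedyRay R

  determining-ray : ∀ {I : Set} → I ↣ ℕ → (c : I → DirectionalChoice G) → ∀ f →
                    DistinguishFromOthers G c f → Σ (GreedyRay f []) Determines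
  determining-ray {I} I↣ℕ c f dist = proj₁ greedy , λ h agree → stable λ f≉h →
    let i , f≐C , h≭C = dist h f≉h
        n , avoid     = proj₂ greedy (to i)
    in h≭C (≐-trans (≐-sym (agree-of-avoids f h (past n) (proj₁ (c i)) (agree n)
         (subst (Avoids _) (goals-to i) avoid))) f≐C)
    where
    open Injection I↣ℕ using (to; injective)

    -- The sets of the choices are listed along the injection into ℕ, with the empty set at numbers
    -- outside its image. By injectivity, the index found at `to i` is `i` itself.
    goals : ℕ → FinSet G
    goals k with em {P = ∃ λ i → to i ≡ k}
    ... | yes (i , _) = proj₁ (c i)
    ... | no _        = []

    goals-to : ∀ i → goals (to i) ≡ proj₁ (c i)
    goals-to i with em {P = ∃ λ j → to j ≡ to i}
    ... | yes (j , eq) with refl ← injective eq = refl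
    ... | no none      = contradiction (i , refl) none

    greedy : Σ (GreedyRay f []) λ R →
      ∀ k → ∃ λ n → Avoids (verts (assign f (GreedyRay.past R n))) (goals k)
    greedy = Greedy.ray-through f [] goals

    open GreedyRay (proj₁ greedy)

  determining⇒directional : ∀ ω (R : GreedyRay (endDirection G em ω) []) → Determines R →
    rays ω (GreedyRay.ray R) × Directional G em (GreedyRay.ray R)
  determining⇒directional ω R determines = ∈-of-tails ω ray ray-tail , directional
    where
    open GreedyRay R

    f g : Direction G
    f = endDirection G em ω
    g = endDirection G em (endOf G ray)

    -- From index `n` on the ray lies in `f (past n)`, so the direction `g` of its own end agrees
    -- with `f` at every `past n`.
    f≈g : _≈ᴰ_ G f g
    f≈g = determines g λ n → endComponent≐ (endOf G ray) ray (assign f (past n)) (∼-refl G em ray)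
      (n , tail-inside n)

    ray-tail : ∀ X → ContainsTail G (verts (endComponent G em X ω)) ray
    ray-tail X =
      let n , in-g = endComponent-tails G em X (endOf G ray) ray (∼-refl G em ray)
      in n , λ m n≤m → proj₂ (f≈g X) (in-g m n≤m)

    directional : Directional G em ray
    -- If no initial segment distinguishes `g` from `h`, then `h` agrees with `f` at every `past n`,
    -- and hence everywhere.
    directional h g≉h = stable λ none → g≉h λ X → ≐-trans (≐-sym (f≈g X)) (determines h (λ n →
      ≐-trans (direction-cong h (past⊆initial R n) (initial⊆past R n))
        (≐-trans (stable λ h≭ → none (n , endComponent-initial ray n , h≭))
          (≐-trans (≐-sym (endComponent-initial ray n))
            (≐-trans (≐-sym (f≈g (initial G ray n)))
              (direction-cong f (initial⊆past R n) (past⊆initial R n)))))) X)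

  countablyDetermined⇒directional : ∀ ω → CountablyDetermined G (endDirection G em ω) →
    ∃ λ R → rays ω R × Directional G em R
  countablyDetermined⇒directional ω (I , I↣ℕ , c , dist) =
    let R , determines = determining-ray I↣ℕ c (endDirection G em ω) dist
    in GreedyRay.ray R , determining⇒directional ω R determines

  -- From directional rays to topological rays

  -- Each vertex of `X` that ever leaves the decreasing sequence does so at some finite stage. The
  -- maximum of these finitely many stages serves as `N`.
  stabilises : ∀ (C : ℕ → Pred V ℓ) → (∀ {m n} → m ≤ n → C n ⊆ C m) → ∀ X →
               ∃ λ N → ∀ {x} → x ∈ X → C N x → ∀ n → C n x
  stabilises C mono [] = 0 , λ ()
  stabilises C mono (x ∷ X) with stabilises C mono X | em {P = ∀ n → C n x}
  ... | N , st | yes always = N , λ { (here refl) _ → always ; (there p) → st p }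
  ... | N , st | no ¬always with ¬∀⇒∃¬ ¬always
  ... | k , ¬c = k ⊔ N , λ where
    (here refl) c → contradiction (mono (m≤m⊔n k N) c) ¬c
    (there p)   c → st p (mono (m≤n⊔m k N) c)

  Misses : Ray G → Pred V ℓ
  Misses R v = ∀ m → v ≢ at R m

  -- K ∩ D misses R: K misses the tail of R from N on, and D the first N vertices.
  exit-missing-ray : ∀ {X} R N (K : Component G X) (D : Component G (initial G R N)) →
    verts D (at R N) → (∀ m → N ≤ m → ¬ verts K (at R m)) → (∀ m → N ≤ m → at R m ∉ X) →
    ∀ {s} → verts K s → verts D s →
    ∃ λ x → x ∈ X × verts D x × Linked G (Misses R) s x
  exit-missing-ray {X} R N K D DR ¬KR R∉X ks ds
    with exit {verts D} {verts K ∩ verts D} (ks , ds) (λ r → ¬KR N ≤-refl (proj₁ r))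
           (proj₂ (component-linked D ds DR))
  ... | y , x , w , _ , y∈@(ky , _) , a , dx , x∉ =
    x , x∈X , dx ,
    linked-trans G (linked-mono G region-misses ((ks , ds) , w))
      (region-misses y∈ ,
       (a , misses dx λ m N≤m eq → R∉X m N≤m (subst (_∈ X) eq x∈X)) ◅ ε)
    where
    misses : ∀ {v} → verts D v → (∀ m → N ≤ m → v ≢ at R m) → Misses R v
    misses d late m eq with <-≤-connex m N
    ... | inj₁ m<N = Component.off D d
                       (subst (_∈ initial G R N) (sym eq) (∈-applyUpTo⁺ (at R) m<N))
    ... | inj₂ N≤m = late m N≤m eq

    region-misses : verts K ∩ verts D ⊆ Misses R
    region-misses (k , d) = misses d λ m N≤m eq → ¬KR m N≤m (subst (verts K) eq k)

    -- The walk stays in `D`, so it left `K`. A neighbour of `K` outside `K` must lie in `X`.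
    x∈X : x ∈ X
    x∈X = stable λ x∉X → x∉ (component-adjacent K ky a x∉X , dx)

  misses⇒off-initial : ∀ R n → Misses R ⊆ Off G (initial G R n)
  misses⇒off-initial R n out p with ∈-applyUpTo⁻ (at R) p
  ... | m , _ , eq = out m eq

  initial-mono : ∀ R {m n} → m ≤ n → initial G R m List.⊆ initial G R n
  initial-mono R m≤n p with ∈-applyUpTo⁻ (at R) p
  ... | i , i<m , refl = ∈-applyUpTo⁺ (at R) (≤-trans i<m m≤n)

  directional⇒topological : ∀ R → Directional G em R → Topological G em R
  directional⇒topological R dir =
    (λ n → Ω-neighbourhood (initial G R n) (Cₙ n) ω ≐-refl) , fine
    where
    ω : End G
    ω = endOf G R

    C : ∀ X → Component G X
    C X = endComponent G em X ω

    Cₙ : ∀ n → Component G (initial G R n)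
    Cₙ n = C (initial G R n)

    Cₙ-mono : ∀ {m n} → m ≤ n → verts (Cₙ n) ⊆ verts (Cₙ m)
    Cₙ-mono m≤n = Direction.mono (endDirection G em ω) (initial-mono R m≤n)

    -- A vertex of a ray in `ω′` is joined, by a walk missing `R`, to some `x` in `X` that belongs
    -- to every `Cₙ n`. No initial segment of `R` meets this walk, so none separates `ω′` from `ω`.
    close⇒agree : ∀ X N → (∀ m → N ≤ m → verts (C X) (at R m)) →
      (∀ {x} → x ∈ X → verts (Cₙ N) x → ∀ n → verts (Cₙ n) x) →
      ∀ ω′ → Ωᴱ G em (initial G R N) ω ω′ → ¬ Ωᴱ G em X ω ω′ →
      ∀ n → Ωᴱ G em (initial G R n) ω ω′
    close⇒agree X N R-in always ω′ close far n =
      let S , S∈ω′ = some-ray ω′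
          i , inK  = endComponent-tails G em X ω′ S S∈ω′
          j , inN  = endComponent-tails G em (initial G R N) ω′ S S∈ω′
          l , inn  = endComponent-tails G em (initial G R n) ω′ S S∈ω′
          -- Late enough for `at S k` to lie in all three components of `ω′`.
          k        = i ⊔ j ⊔ l
          x , x∈X , x∈C , lk = exit-missing-ray R N K (Cₙ N)
            (proj₂ (endComponent-initial R N) (tailComponent-contains G R N N ≤-refl))
            (λ m N≤m km → far (overlap⇒≐ K (C X) km (R-in m N≤m)))
            (λ m N≤m → Component.off (C X) (R-in m N≤m))
            (inK k (≤-trans (m≤m⊔n i j) (m≤m⊔n (i ⊔ j) l)))
            (proj₁ close (inN k (≤-trans (m≤n⊔m i j) (m≤m⊔n (i ⊔ j) l))))
      in overlap⇒≐ (endComponent G em (initial G R n) ω′) (Cₙ n)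
           (inn k (m≤n⊔m (i ⊔ j) l))
           (component-closed G (Cₙ n) (always x∈X x∈C n)
             (linked-sym G (linked-mono G (misses⇒off-initial R n) lk)))
      where
      K : Component G X
      K = endComponent G em X ω′

    base : ∀ X → ∃ λ n → Ωᴱ G em (initial G R n) ω ⊆ Ωᴱ G em X ω
    base X =
      -- From `N₁` on, no vertex of `X` leaves the components along `R`; from `N₂` on, `R` stays in
      -- `C X`. An end that is close at `N` but far at `X` then contradicts `dir`.
      let N₁ , always = stabilises (λ n → verts (Cₙ n)) Cₙ-mono X
          N₂ , R-in   = endComponent-tails G em X ω R (∼-refl G em R)
          N           = N₁ ⊔ N₂
      in N , λ {ω′} close → stable λ far →
        let n , _ , ≭tail = dir (endDirection G em ω′) (λ same → far (≐-sym (same X)))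
        in ≭tail (≐-trans
             (close⇒agree X N (λ m N≤m → R-in m (≤-trans (m≤n⊔m N₁ N₂) N≤m))
               (λ x∈X c → always x∈X (Cₙ-mono (m≤m⊔n N₁ N₂) c)) ω′ close far n)
             (endComponent-initial R n))

    fine : ∀ N → Neighbourhood G em ω N → ∃ λ n → Ωᴱ G em (initial G R n) ω ⊆ N
    fine N (_ , U , op , Uω , U⊆N) =
      let X , D , ω∈Ω , Ω⊆U = op ω Uω
          n , Ωₙ⊆ = base X
      in n , λ {x} close → U⊆N {x} (Ω⊆U {x} (≐-trans (Ωₙ⊆ {x} close) ω∈Ω))

theorem3p2 : ∀ (em : Classical) {ℓ} (G : Graph ℓ) (ω : End G) →
    (FirstCountableAt G em ω ⇔ CountablyDetermined G (endDirection G em ω)) ×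
    (CountablyDetermined G (endDirection G em ω) ⇔ (∃ λ R → rays ω R × Directional G em R)) ×
    ((∃ λ R → rays ω R × Directional G em R) ⇔ (∃ λ R → rays ω R × Topological G em R))
theorem3p2 em G ω =
  -- The converse (ii)⇒(i) goes round the cycle through (iii) and (iv).
  mk⇔ (firstCountable⇒countablyDetermined em G ω) ii⇒i ,
  mk⇔ ii⇒iii (λ (R , R∈ω , dir) → directional⇒countablyDetermined em G ω R∈ω dir) ,
  mk⇔ iii⇒iv (λ (R , R∈ω , top) → R , R∈ω , topological⇒directional em G R top)
  where
  ii⇒iii : CountablyDetermined G (endDirection G em ω) → ∃ λ R → rays ω R × Directional G em R
  ii⇒iii = countablyDetermined⇒directional em G ω

  iii⇒iv : (∃ λ R → rays ω R × Directional G em R) → ∃ λ R → rays ω R × Topological G em R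
  iii⇒iv (R , R∈ω , dir) = R , R∈ω , directional⇒topological em G R dir

  iv⇒i : (∃ λ R → rays ω R × Topological G em R) → FirstCountableAt G em ω
  iv⇒i (R , R∈ω , top) = topological⇒firstCountable em G ω R∈ω top

  ii⇒i : CountablyDetermined G (endDirection G em ω) → FirstCountableAt G em ω
  ii⇒i = iv⇒i ∘ iii⇒iv ∘ ii⇒iii
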